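{- For every positive integer $n>4$ there is a prime number $p$ with $6n<p<7n$. -}

module Defs where

{-# OPTIONS --safe #-}

-- Chebyshev's method.  Let R(q) be the quotient of the products of the factorials (1680 q / d) !
-- with d in `numerator` and with d in `denominator`.  By Legendre's formula the exponent of a
-- prime p in R(q) is the sum over j ≥ 1 of F(⌊1680 q / pʲ⌋), where F(w) is the sum of ⌊w / d⌋ over
-- `numerator` minus that over `denominator`.  Here F ≤ 1 everywhere and F(w) ≤ 0 for w < 560,
-- w ≠ 7, while w = 7 corresponds to 210 q < pʲ ≤ 240 q.  If that interval contains no prime, only
-- primes up to √(240 q) and primes up to 3 q contribute, so R(q) ≤ (240 q) ^ (1 + √(240 q)) * 4 ^ (3 q).
-- On the other hand R(q) grows like κ ^ q with log₂ κ > 11, which is impossible once 240 q ≥ 2 ^ 24.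
-- Since 240 / 210 < 7 / 6, the interval (6 n , 7 n) contains (210 q , 240 q] for q = ⌊7 n / 240⌋;
-- the remaining n < 2400000 are covered by an explicit chain of primes.

module Submission where

open import Defs
open import Data.Bool.Base using (Bool; false; T; _∧_; _∨_)
open import Data.Bool.Properties using (T-∧; T-∨)
open import Data.List.Base using (List; []; _∷_; map)
open import Data.List.Relation.Unary.All using (All; []; _∷_; all?)
open import Data.Nat.Base
open import Data.Nat.Divisibility
open import Data.Nat.DivMod
open import Data.Nat.Induction using (<-rec)
open import Data.Nat.ListAction using (product; sum)
open import Data.Nat.Primality
open import Data.Nat.Primality.Factorisation using (factorise)
open import Data.Nat.Properties
open import Data.Nat.Tactic.RingSolver using (solve-∀)
open import Data.Product.Base using (∃-syntax; _×_; _,_)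
open import Data.Sum.Base using (_⊎_; inj₁; inj₂)
open import Data.Unit.Base using (tt)
open import Function.Base using (_∘_)
open import Function.Bundles using (Equivalence)
open import Relation.Binary.PropositionalEquality
open import Relation.Nullary using (¬_; Dec; yes; no; contradiction)
open import Relation.Nullary.Decidable using (from-yes; ¬?; _→-dec_; _×-dec_)

-- Indicators, finite sums and products over primes

⟦_⟧ : ∀ {A : Set} → Dec A → ℕ
⟦ yes _ ⟧ = 1
⟦ no _ ⟧ = 0

⟦⟧-true : ∀ {A : Set} {d : Dec A} → A → ⟦ d ⟧ ≡ 1
⟦⟧-true {d = yes _} _ = refl
⟦⟧-true {d = no ¬a} a = contradiction a ¬a

⟦⟧-false : ∀ {A : Set} {d : Dec A} → ¬ A → ⟦ d ⟧ ≡ 0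
⟦⟧-false {d = yes a} ¬a = contradiction a ¬a
⟦⟧-false {d = no _} _ = refl

⟦⟧-cong : ∀ {A B : Set} {d : Dec A} {e : Dec B} → (A → B) → (B → A) → ⟦ d ⟧ ≡ ⟦ e ⟧
⟦⟧-cong {d = yes a} f g = sym (⟦⟧-true (f a))
⟦⟧-cong {d = no ¬a} f g = sym (⟦⟧-false (¬a ∘ g))

∑ : ℕ → (ℕ → ℕ) → ℕ
∑ zero    f = 0
∑ (suc n) f = ∑ n f + f n

∑-cong : ∀ n {f g : ℕ → ℕ} → (∀ i → f i ≡ g i) → ∑ n f ≡ ∑ n g
∑-cong zero    eq = refl
∑-cong (suc n) eq = cong₂ _+_ (∑-cong n eq) (eq n)

∑-mono : ∀ n {f g : ℕ → ℕ} → (∀ i → f i ≤ g i) → ∑ n f ≤ ∑ n g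
∑-mono zero    le = z≤n
∑-mono (suc n) le = +-mono-≤ (∑-mono n le) (le n)

∑-+ : ∀ n (f g : ℕ → ℕ) → ∑ n (λ i → f i + g i) ≡ ∑ n f + ∑ n g
∑-+ zero    f g = refl
∑-+ (suc n) f g rewrite ∑-+ n f g = lemma (∑ n f) (∑ n g) (f n) (g n)
  where
  lemma : ∀ a b c d → a + b + (c + d) ≡ a + c + (b + d)
  lemma = solve-∀

∑-0 : ∀ n → ∑ n (λ _ → 0) ≡ 0
∑-0 zero    = refl
∑-0 (suc n) = trans (+-identityʳ _) (∑-0 n)

∑-head : ∀ n (f : ℕ → ℕ) → ∑ (suc n) f ≡ f 0 + ∑ n (f ∘ suc)
∑-head zero    f = sym (+-identityʳ (f 0))
∑-head (suc n) f = trans (cong (_+ f (suc n)) (∑-head n f)) (+-assoc (f 0) _ _)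

-- The product of p ^ f p over the primes p < n.
∏ᵖ : ℕ → (ℕ → ℕ) → ℕ
∏ᵖ zero    f = 1
∏ᵖ (suc n) f = ∏ᵖ n f * n ^ (⟦ prime? n ⟧ * f n)

prime⇒1≤ : ∀ {p} → Prime p → 1 ≤ p
prime⇒1≤ p = >-nonZero⁻¹ _ {{prime⇒nonZero p}}

prime⇒2≤ : ∀ {p} → Prime p → 2 ≤ p
prime⇒2≤ p = nonTrivial⇒n>1 _ {{prime⇒nonTrivial p}}

^-monoʳ : ∀ {b m n} → 1 ≤ b → m ≤ n → b ^ m ≤ b ^ n
^-monoʳ {b} 1≤b = ^-monoʳ-≤ b {{>-nonZero 1≤b}}

∏ᵖ-mono : ∀ n {f g : ℕ → ℕ} → (∀ {p} → Prime p → f p ≤ g p) → ∏ᵖ n f ≤ ∏ᵖ n g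
∏ᵖ-mono zero    le = ≤-refl
∏ᵖ-mono (suc n) {f} {g} le = *-mono-≤ (∏ᵖ-mono n le) step
  where
  step : n ^ (⟦ prime? n ⟧ * f n) ≤ n ^ (⟦ prime? n ⟧ * g n)
  step with prime? n
  ... | yes p = ^-monoʳ (prime⇒1≤ p) (+-monoˡ-≤ 0 (le p))
  ... | no _  = ≤-refl

∏ᵖ-cong : ∀ n {f g : ℕ → ℕ} → (∀ {p} → Prime p → f p ≡ g p) → ∏ᵖ n f ≡ ∏ᵖ n g
∏ᵖ-cong n eq = ≤-antisym (∏ᵖ-mono n (≤-reflexive ∘ eq)) (∏ᵖ-mono n (≤-reflexive ∘ sym ∘ eq))

∏ᵖ-+ : ∀ n (f g : ℕ → ℕ) → ∏ᵖ n (λ p → f p + g p) ≡ ∏ᵖ n f * ∏ᵖ n g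
∏ᵖ-+ zero    f g = refl
∏ᵖ-+ (suc n) f g = begin
  ∏ᵖ n (λ p → f p + g p) * n ^ (b * (f n + g n))
    ≡⟨ cong₂ (λ u v → u * n ^ v) (∏ᵖ-+ n f g) (*-distribˡ-+ b (f n) (g n)) ⟩
  ∏ᵖ n f * ∏ᵖ n g * n ^ (b * f n + b * g n)
    ≡⟨ cong (∏ᵖ n f * ∏ᵖ n g *_) (^-distribˡ-+-* n (b * f n) (b * g n)) ⟩
  ∏ᵖ n f * ∏ᵖ n g * (n ^ (b * f n) * n ^ (b * g n))
    ≡⟨ lemma (∏ᵖ n f) (∏ᵖ n g) (n ^ (b * f n)) (n ^ (b * g n)) ⟩
  ∏ᵖ n f * n ^ (b * f n) * (∏ᵖ n g * n ^ (b * g n)) ∎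
  where
  open ≡-Reasoning
  b = ⟦ prime? n ⟧
  lemma : ∀ a b c d → a * b * (c * d) ≡ a * c * (b * d)
  lemma = solve-∀

∏ᵖ-0 : ∀ n → ∏ᵖ n (λ _ → 0) ≡ 1
∏ᵖ-0 zero    = refl
∏ᵖ-0 (suc n) rewrite *-zeroʳ ⟦ prime? n ⟧ = trans (*-identityʳ _) (∏ᵖ-0 n)

∏ᵖ-outside : ∀ {r} n → n ≤ r → ∏ᵖ n (λ p → ⟦ p ≟ r ⟧) ≡ 1
∏ᵖ-outside zero    _   = refl
∏ᵖ-outside {r} (suc n) n<r
  rewrite ⟦⟧-false {d = n ≟ r} (<⇒≢ n<r) | *-zeroʳ ⟦ prime? n ⟧ =
  trans (*-identityʳ _) (∏ᵖ-outside n (<⇒≤ n<r))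

∏ᵖ-single : ∀ {r} n → Prime r → r < n → ∏ᵖ n (λ p → ⟦ p ≟ r ⟧) ≡ r
∏ᵖ-single {r} (suc n) pr r<1+n with m<1+n⇒m<n∨m≡n r<1+n
... | inj₁ r<n
  rewrite ⟦⟧-false {d = n ≟ r} (<⇒≢ r<n ∘ sym) | *-zeroʳ ⟦ prime? n ⟧ =
  trans (*-identityʳ _) (∏ᵖ-single n pr r<n)
... | inj₂ refl
  rewrite ⟦⟧-true {d = n ≟ n} refl | ⟦⟧-true {d = prime? n} pr | ∏ᵖ-outside n ≤-refl =
  trans (*-identityˡ _) (^-identityʳ n)

-- Each of the `suc r` indices 0, ..., `r`, prime or not, is charged a factor of at most `y`; every
-- later index contributes 1. This crude count of primes is the source of the exponent 1 + √(240 q).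
∏ᵖ-bounded : ∀ n r {y} {f : ℕ → ℕ} → 1 ≤ y → (∀ {p} → Prime p → p ^ f p ≤ y) →
             (∀ p → r < p → f p ≡ 0) → ∏ᵖ n f ≤ y ^ suc r
∏ᵖ-bounded n r {y} {f} 1≤y small vanish = go n
  where
  factor : ∀ n → n ^ (⟦ prime? n ⟧ * f n) ≤ y
  factor n with prime? n
  ... | yes p = ≤-trans (≤-reflexive (cong (n ^_) (+-identityʳ (f n)))) (small p)
  ... | no _  = 1≤y

  crude : ∀ n → ∏ᵖ n f ≤ y ^ n
  crude zero    = ≤-refl
  crude (suc n) = ≤-trans (*-mono-≤ (crude n) (factor n)) (≤-reflexive (*-comm (y ^ n) y))

  go : ∀ n → ∏ᵖ n f ≤ y ^ suc r
  go zero = ^-monoʳ {n = suc r} 1≤y z≤n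
  go (suc n) with n ≤? r
  ... | yes n≤r = ≤-trans (crude (suc n)) (^-monoʳ 1≤y (s≤s n≤r))
  ... | no n≰r rewrite vanish n (≰⇒> n≰r) | *-zeroʳ ⟦ prime? n ⟧ =
    ≤-trans (≤-reflexive (*-identityʳ _)) (go n)

-- Floor division

-- Division that is total by the junk value n ÷ 0 = 0, so that no instance argument is needed
-- under sums and products.
infixl 7 _÷_

_÷_ : ℕ → ℕ → ℕ
n ÷ zero  = 0
n ÷ suc k = n / suc k

÷≡/ : ∀ n k .{{_ : NonZero k}} → n ÷ k ≡ n / k
÷≡/ n (suc k) = refl

÷-small : ∀ {n k} → n < k → n ÷ k ≡ 0
÷-small {k = suc _} n<k = m<n⇒m/n≡0 n<k

÷-+* : ∀ m c k .{{_ : NonZero k}} → (m + c * k) ÷ k ≡ m ÷ k + c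
÷-+* m c k@(suc _) = trans (+-distrib-/-∣ʳ m (divides-refl c)) (cong (m / k +_) (m*n/n≡m c k))

-- If `suc n = suc c * k`, then `n = k′ + c * k` has quotient `c`. Otherwise the remainder of
-- `suc n` is some `suc r`, and `n` has remainder `r` with the same quotient.
÷-suc : ∀ n k → 1 ≤ k → suc n ÷ k ≡ ⟦ k ∣? suc n ⟧ + n ÷ k
÷-suc n k@(suc k′) _ with k ∣? suc n
... | yes (divides (suc c) eq) = begin
  suc n / k             ≡⟨ cong (_÷ k) eq ⟩
  (suc c * k) ÷ k       ≡⟨ m*n/n≡m (suc c) k ⟩
  suc c                 ≡⟨ cong suc (cong (_+ c) (÷-small {k′} {k} ≤-refl)) ⟨
  suc (k′ ÷ k + c)      ≡⟨ cong suc (÷-+* k′ c k) ⟨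
  suc ((k′ + c * k) ÷ k) ≡⟨ cong (λ m → suc (m ÷ k)) (suc-injective eq) ⟨
  suc (n / k)           ∎
  where open ≡-Reasoning
... | no k∤1+n with suc n % k in eq
...   | zero  = contradiction (m%n≡0⇒n∣m (suc n) k eq) k∤1+n
...   | suc r = sym (begin
  n / k             ≡⟨ cong (_÷ k) (suc-injective (trans (m≡m%n+[m/n]*n (suc n) k) (cong (_+ c * k) eq))) ⟩
  (r + c * k) ÷ k   ≡⟨ ÷-+* r c k ⟩
  r ÷ k + c         ≡⟨ cong (_+ c) (÷-small (<-trans (n<1+n r) (subst (_< k) eq (m%n<n (suc n) k)))) ⟩
  c                 ∎)
  where
  open ≡-Reasoning
  c = suc n / k

÷-superadditive : ∀ m n k → m ÷ k + n ÷ k ≤ (m + n) ÷ k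
÷-superadditive m n zero      = z≤n
÷-superadditive m n k@(suc _) = begin
  m / k + n / k             ≡⟨ m*n/n≡m (m / k + n / k) k ⟨
  (m / k + n / k) * k / k   ≤⟨ /-monoˡ-≤ k (≤-trans (≤-reflexive (*-distribʳ-+ k (m / k) (n / k)))
                                 (+-mono-≤ (m/n*n≤m m k) (m/n*n≤m n k))) ⟩
  (m + n) / k               ∎
  where open ≤-Reasoning

÷-÷ : ∀ a d q k → 1 ≤ k → 1 ≤ d → (a * q) ÷ k ≡ (d * a * q) ÷ k ÷ d
÷-÷ a d@(suc _) q k@(suc _) _ _ = sym (begin
  d * a * q / k / d       ≡⟨ m/n/o≡m/[n*o] (d * a * q) k d ⟩
  d * a * q / (k * d)     ≡⟨ cong (_÷ (k * d)) (*-assoc d a q) ⟩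
  d * (a * q) ÷ (k * d)   ≡⟨ cong (d * (a * q) ÷_) (*-comm k d) ⟩
  d * (a * q) / (d * k)   ≡⟨ m*n/m*o≡n/o d (a * q) k ⟩
  a * q / k               ∎)
  where open ≡-Reasoning

-- Multiplicities and Legendre's formula

n<b^n : ∀ {b} n → 2 ≤ b → n < b ^ n
n<b^n zero    _   = s≤s z≤n
n<b^n {b} (suc n) 2≤b = begin
  suc (suc n)         ≤⟨ s≤s (n<b^n n 2≤b) ⟩
  1 + b ^ n           ≤⟨ +-monoˡ-≤ (b ^ n) (≤-trans (s≤s z≤n) (n<b^n n 2≤b)) ⟩
  b ^ n + b ^ n       ≡⟨ cong (b ^ n +_) (+-identityʳ (b ^ n)) ⟨
  2 * b ^ n           ≤⟨ *-monoˡ-≤ (b ^ n) 2≤b ⟩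
  b ^ suc n           ∎
  where open ≤-Reasoning

1≤p^ : ∀ {p} k → Prime p → 1 ≤ p ^ k
1≤p^ k pr = m^n>0 _ {{prime⇒nonZero pr}} k

prime∤prime : ∀ {p r} → Prime p → Prime r → p ≢ r → ¬ p ∣ r
prime∤prime pp pr p≢r p∣r with prime⇒irreducible pr p∣r
... | inj₁ refl = ¬prime[1] pp
... | inj₂ eq   = p≢r eq

-- Euclid's lemma moves one factor `p` at a time into `m`: write `m = m′ * p`, cancel `p`, and
-- repeat with `k` and `m′`.
prime-power-∣ : ∀ {p r} k m → Prime p → Prime r → p ≢ r → p ^ k ∣ r * m → p ^ k ∣ m
prime-power-∣ zero m _ _ _ _ = 1∣ m
prime-power-∣ {p} {r} (suc k) m pp pr p≢r p^∣ with euclidsLemma r m pp (m*n∣⇒m∣ p (p ^ k) p^∣)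
... | inj₁ p∣r = contradiction p∣r (prime∤prime pp pr p≢r)
... | inj₂ (divides m′ refl) = subst (p * p ^ k ∣_) (*-comm p m′) (*-monoʳ-∣ p (prime-power-∣ k m′ pp pr p≢r
  (*-cancelˡ-∣ p {{prime⇒nonZero pp}} (subst (p * p ^ k ∣_) (lemma r m′ p) p^∣))))
  where
  lemma : ∀ r m p → r * (m * p) ≡ p * (r * m)
  lemma = solve-∀

-- The exponent of `p` in `n`, counted as the number of powers of `p` dividing `n` so that it can be
-- compared termwise with Legendre's sum. For `p ≥ 2` and `0 < n < b` the cutoff loses nothing,
-- since `p ^ b > b`.
multiplicity : ℕ → ℕ → ℕ → ℕ
multiplicity b p n = ∑ b (λ j → ⟦ p ^ suc j ∣? n ⟧)

multiplicity-1 : ∀ b {p} → Prime p → multiplicity b p 1 ≡ 0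
multiplicity-1 b {p} pp = trans (∑-cong b λ j → ⟦⟧-false (λ d → <⇒≢ (1<p^ j) (sym (∣1⇒≡1 d)))) (∑-0 b)
  where
  1<p^ : ∀ j → 1 < p ^ suc j
  1<p^ j = <-≤-trans (s≤s (s≤s z≤n)) (n<b^n (suc j) (prime⇒2≤ pp))

-- For `p = r`, cancelling one `p` shifts the powers by one, and the freed first term gives the
-- additional 1. For `p ≢ r`, a power of `p` divides `r * m` exactly when it divides `m`.
multiplicity-* : ∀ b {p r} m → Prime p → Prime r → 1 ≤ m → m < b →
                 multiplicity b p (r * m) ≡ ⟦ p ≟ r ⟧ + multiplicity b p m
multiplicity-* b@(suc b′) {p} {r} m pp pr 1≤m m<b with p ≟ r
... | no p≢r = ∑-cong b λ j → ⟦⟧-cong (prime-power-∣ (suc j) m pp pr p≢r) (∣n⇒∣m*n r)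
... | yes refl = begin
  multiplicity b p (p * m)
    ≡⟨ ∑-head b′ _ ⟩
  ⟦ p * 1 ∣? p * m ⟧ + ∑ b′ (λ j → ⟦ p * p ^ suc j ∣? p * m ⟧)
    ≡⟨ cong₂ _+_ (⟦⟧-true (*-monoʳ-∣ p (1∣ m)))
                 (∑-cong b′ λ j → ⟦⟧-cong (*-cancelˡ-∣ p) (*-monoʳ-∣ p)) ⟩
  1 + ∑ b′ (λ j → ⟦ p ^ suc j ∣? m ⟧)
    -- The shifted sum is one term short; the missing term tests `p ^ b ∣ m` and vanishes because
    -- `m < b < p ^ b`.
    ≡⟨ cong suc (+-identityʳ _) ⟨
  1 + (∑ b′ (λ j → ⟦ p ^ suc j ∣? m ⟧) + 0)
    ≡⟨ cong (λ v → 1 + (∑ b′ (λ j → ⟦ p ^ suc j ∣? m ⟧) + v))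
         (⟦⟧-false (λ d → <⇒≱ (<-trans m<b (n<b^n b (prime⇒2≤ pp))) (∣⇒≤ d))) ⟨
  1 + multiplicity b p m ∎
  where
  open ≡-Reasoning
  instance
    _ = >-nonZero 1≤m
    _ = prime⇒nonZero pp

product-multiplicity : ∀ b as → All Prime as → product as < b →
                       product as ≡ ∏ᵖ b (λ p → multiplicity b p (product as))
product-multiplicity b [] [] _ = sym (trans (∏ᵖ-cong b (multiplicity-1 b)) (∏ᵖ-0 b))
product-multiplicity b (r ∷ as) (pr ∷ pas) n<b = begin
  r * m                                                ≡⟨ cong₂ _*_ (sym (∏ᵖ-single b pr (≤-<-trans (m≤m*n r m) n<b)))
                                                                    (product-multiplicity b as pas m<b) ⟩
  ∏ᵖ b (λ p → ⟦ p ≟ r ⟧) * ∏ᵖ b (λ p → multiplicity b p m) ≡⟨ ∏ᵖ-+ b _ _ ⟨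
  ∏ᵖ b (λ p → ⟦ p ≟ r ⟧ + multiplicity b p m)              ≡⟨ ∏ᵖ-cong b (λ pp → multiplicity-* b m pp pr (productOfPrimes≥1 pas) m<b) ⟨
  ∏ᵖ b (λ p → multiplicity b p (r * m))                    ∎
  where
  open ≡-Reasoning
  m = product as
  instance
    _ = prime⇒nonZero pr
    _ = productOfPrimes≢0 pas
  m<b = ≤-<-trans (m≤n*m m r) n<b

n≡∏ᵖmultiplicity : ∀ b n .{{_ : NonZero n}} → n < b → n ≡ ∏ᵖ b (λ p → multiplicity b p n)
n≡∏ᵖmultiplicity b n n<b with factorise n
... | record { factors = as ; isFactorisation = refl ; factorsPrime = pas } = product-multiplicity b as pas n<b

factorialMultiplicity : ℕ → ℕ → ℕ → ℕ
factorialMultiplicity b p n = ∑ b (λ j → n ÷ p ^ suc j)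

-- Passing from `n` to `suc n` raises the quotient by `p ^ suc j` exactly when that power divides
-- `suc n`. Since any cutoff `b > n` is allowed, several factorials can share one cutoff and be
-- multiplied prime by prime.
legendre : ∀ b n → n < b → n ! ≡ ∏ᵖ b (λ p → factorialMultiplicity b p n)
legendre b zero _ = sym (trans (∏ᵖ-cong b λ pp → trans (∑-cong b λ j → ÷-small (1≤p^ (suc j) pp)) (∑-0 b)) (∏ᵖ-0 b))
legendre b (suc n) 1+n<b = begin
  suc n * n !
    ≡⟨ cong₂ _*_ (n≡∏ᵖmultiplicity b (suc n) 1+n<b) (legendre b n (<⇒≤ 1+n<b)) ⟩
  ∏ᵖ b (λ p → multiplicity b p (suc n)) * ∏ᵖ b (λ p → factorialMultiplicity b p n)
    ≡⟨ ∏ᵖ-+ b _ _ ⟨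
  ∏ᵖ b (λ p → multiplicity b p (suc n) + factorialMultiplicity b p n)
    ≡⟨ ∏ᵖ-cong b (λ {p} pp → trans (∑-cong b λ j → ÷-suc n (p ^ suc j) (1≤p^ (suc j) pp)) (∑-+ b _ _)) ⟨
  ∏ᵖ b (λ p → factorialMultiplicity b p (suc n)) ∎
  where open ≡-Reasoning

-- The bound 4 ^ x for the primorial

m!*m^k≤[m+k]! : ∀ m k → m ! * m ^ k ≤ (k + m) !
m!*m^k≤[m+k]! m zero    = ≤-reflexive (*-identityʳ (m !))
m!*m^k≤[m+k]! m (suc k) = begin
  m ! * (m * m ^ k)       ≡⟨ lemma (m !) m (m ^ k) ⟩
  m * (m ! * m ^ k)       ≤⟨ *-mono-≤ (m≤n+m m (suc k)) (m!*m^k≤[m+k]! m k) ⟩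
  (suc k + m) * (k + m) ! ∎
  where
  open ≤-Reasoning
  lemma : ∀ a b c → a * (b * c) ≡ b * (a * c)
  lemma = solve-∀

[m+k]!≤m!*[m+k]^k : ∀ m k → (k + m) ! ≤ m ! * (k + m) ^ k
[m+k]!≤m!*[m+k]^k m zero    = ≤-reflexive (sym (*-identityʳ (m !)))
[m+k]!≤m!*[m+k]^k m (suc k) = begin
  (suc k + m) * (k + m) !             ≤⟨ *-monoʳ-≤ (suc k + m) ([m+k]!≤m!*[m+k]^k m k) ⟩
  (suc k + m) * (m ! * (k + m) ^ k)   ≤⟨ *-monoʳ-≤ (suc k + m) (*-monoʳ-≤ (m !) (^-monoˡ-≤ k (n≤1+n (k + m)))) ⟩
  (suc k + m) * (m ! * (suc k + m) ^ k) ≡⟨ lemma (suc k + m) (m !) ((suc k + m) ^ k) ⟩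
  m ! * (suc k + m) ^ suc k           ∎
  where
  open ≤-Reasoning
  lemma : ∀ a b c → a * (b * c) ≡ b * (a * c)
  lemma = solve-∀

-- The central binomial coefficient is at most `4 ^ l`: each step multiplies it by
-- (2l+2)(2l+1)/(l+1)², which is at most 4.
[l+l]!≤ : ∀ l → (l + l) ! ≤ 4 ^ l * (l ! * l !)
[l+l]!≤ zero    = ≤-refl
[l+l]!≤ (suc l) = begin
  (suc l + suc l) !                             ≡⟨ cong _! (cong suc (+-suc l l)) ⟩
  (2 + (l + l)) * ((1 + (l + l)) * (l + l) !)   ≡⟨ *-assoc (2 + (l + l)) (1 + (l + l)) ((l + l) !) ⟨
  (2 + (l + l)) * (1 + (l + l)) * (l + l) !     ≤⟨ *-mono-≤ (*-monoʳ-≤ (2 + (l + l)) (n≤1+n (1 + (l + l)))) ([l+l]!≤ l) ⟩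
  (2 + (l + l)) * (2 + (l + l)) * (4 ^ l * (l ! * l !)) ≡⟨ lemma l (4 ^ l) (l !) ⟩
  4 * 4 ^ l * (suc l * l ! * (suc l * l !))     ∎
  where
  open ≤-Reasoning
  lemma : ∀ l x f → (2 + (l + l)) * (2 + (l + l)) * (x * (f * f)) ≡ 4 * x * (suc l * f * (suc l * f))
  lemma = solve-∀

-- The same induction, with (2l+3)(2l+2) ≤ (2l+4)(2l+2) = 4(l+2)(l+1).
[1+l+l]!≤ : ∀ l → (suc l + l) ! ≤ 4 ^ l * (suc l ! * l !)
[1+l+l]!≤ zero    = ≤-refl
[1+l+l]!≤ (suc l) = begin
  (suc (suc l) + suc l) !                               ≡⟨ cong _! (cong (suc ∘ suc) (+-suc l l)) ⟩
  (3 + (l + l)) * ((2 + (l + l)) * (suc l + l) !)       ≡⟨ *-assoc (3 + (l + l)) (2 + (l + l)) ((suc l + l) !) ⟨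
  (3 + (l + l)) * (2 + (l + l)) * (suc l + l) !         ≤⟨ *-mono-≤ (*-monoˡ-≤ (2 + (l + l)) (n≤1+n (3 + (l + l)))) ([1+l+l]!≤ l) ⟩
  (4 + (l + l)) * (2 + (l + l)) * (4 ^ l * (suc l ! * l !)) ≡⟨ lemma l (4 ^ l) (suc l !) (l !) ⟩
  4 * 4 ^ l * (suc (suc l) * suc l ! * (suc l * l !))   ∎
  where
  open ≤-Reasoning
  lemma : ∀ l x f g → (4 + (l + l)) * (2 + (l + l)) * (x * (f * g)) ≡ 4 * x * (suc (suc l) * f * (suc l * g))
  lemma = solve-∀

halves : ∀ n → ∃[ h ] ∃[ l ] (n ≡ h + l × (h ≡ l ⊎ h ≡ suc l))
halves zero = 0 , 0 , refl , inj₁ refl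
halves (suc n) with halves n
... | h , l , refl , inj₁ refl = suc h , l , refl , inj₂ refl
... | h , l , refl , inj₂ refl = h , h , cong suc (sym (+-suc l l)) , inj₁ refl

primorial : ℕ → ℕ → ℕ
primorial b x = ∏ᵖ b (λ p → ⟦ p ≤? x ⟧)

-- A prime `p` with `h < p ≤ h + l` divides `(h + l) !` but neither `h !` nor `l !`, so the product
-- of these primes divides the binomial coefficient. Exponents are compared prime by prime, with all
-- denominators cleared.
primorial-halves : ∀ b h l → l ≤ h → h + l < b → h ! * l ! * primorial b (h + l) ≤ (h + l) ! * primorial b h
primorial-halves b@(suc b′) h l l≤h x<b = begin
  h ! * l ! * primorial b x
    ≡⟨ cong₂ (λ u v → u * v * primorial b x) (legendre b h (≤-<-trans (m≤m+n h l) x<b))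
             (legendre b l (≤-<-trans (m≤n+m l h) x<b)) ⟩
  ∏ᵖ b (λ p → E p h) * ∏ᵖ b (λ p → E p l) * primorial b x
    ≡⟨ cong (_* primorial b x) (∏ᵖ-+ b _ _) ⟨
  ∏ᵖ b (λ p → E p h + E p l) * primorial b x
    ≡⟨ ∏ᵖ-+ b _ _ ⟨
  ∏ᵖ b (λ p → E p h + E p l + ⟦ p ≤? x ⟧)
    ≤⟨ ∏ᵖ-mono b exponents ⟩
  ∏ᵖ b (λ p → E p x + ⟦ p ≤? h ⟧)
    ≡⟨ ∏ᵖ-+ b _ _ ⟩
  ∏ᵖ b (λ p → E p x) * primorial b h
    ≡⟨ cong (_* primorial b h) (legendre b x x<b) ⟨
  x ! * primorial b h ∎
  where
  open ≤-Reasoning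
  x = h + l
  E = factorialMultiplicity b

  -- The reindexing `s` serves both the full Legendre sum and the sum without its first term.
  superadditive : ∀ p b (s : ℕ → ℕ) → ∑ b (λ j → h ÷ p ^ s j) + ∑ b (λ j → l ÷ p ^ s j) ≤ ∑ b (λ j → x ÷ p ^ s j)
  superadditive p b s = ≤-trans (≤-reflexive (sym (∑-+ b _ _)))
                                 (∑-mono b λ j → ÷-superadditive h l (p ^ s j))

  new : ∀ {p} → Prime p → h < p → p ≤ x → h ÷ (p * 1) + l ÷ (p * 1) + 1 ≤ x ÷ (p * 1)
  new {p} pp h<p p≤x rewrite *-identityʳ p | ÷-small h<p | ÷-small (≤-<-trans l≤h h<p) =
    ≤-trans (m≥n⇒m/n>0 {{prime⇒nonZero pp}} p≤x) (≤-reflexive (sym (÷≡/ x p {{prime⇒nonZero pp}})))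

  shuffle : ∀ a c d e → a + c + (d + e) + 1 ≡ a + d + 1 + (c + e)
  shuffle = solve-∀

  exponents : ∀ {p} → Prime p → E p h + E p l + ⟦ p ≤? x ⟧ ≤ E p x + ⟦ p ≤? h ⟧
  exponents {p} pp with p ≤? h | p ≤? x
  ... | yes _   | yes _   = +-monoˡ-≤ 1 (superadditive p b suc)
  ... | yes p≤h | no p≰x  = contradiction (≤-trans p≤h (m≤m+n h l)) p≰x
  ... | no _    | no _    = +-monoˡ-≤ 0 (superadditive p b suc)
  -- The additional 1 is absorbed by the first power of `p`, where the quotients of `h` and `l` are
  -- 0 and that of `x` is at least 1.
  ... | no p≰h  | yes p≤x = begin
    E p h + E p l + 1
      ≡⟨ cong₂ (λ u v → u + v + 1) (∑-head b′ _) (∑-head b′ _) ⟩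
    h ÷ (p * 1) + ∑ b′ (λ j → h ÷ p ^ suc (suc j)) + (l ÷ (p * 1) + ∑ b′ (λ j → l ÷ p ^ suc (suc j))) + 1
      ≡⟨ shuffle (h ÷ (p * 1)) _ (l ÷ (p * 1)) _ ⟩
    h ÷ (p * 1) + l ÷ (p * 1) + 1 + (∑ b′ (λ j → h ÷ p ^ suc (suc j)) + ∑ b′ (λ j → l ÷ p ^ suc (suc j)))
      ≤⟨ +-mono-≤ (new pp (≰⇒> p≰h) p≤x) (superadditive p b′ (suc ∘ suc)) ⟩
    x ÷ (p * 1) + ∑ b′ (λ j → x ÷ p ^ suc (suc j))
      ≡⟨ ∑-head b′ _ ⟨
    E p x
      ≡⟨ +-identityʳ (E p x) ⟨
    E p x + 0 ∎

factorial-halves : ∀ h l → h ≡ l ⊎ h ≡ suc l → (h + l) ! ≤ 4 ^ l * (h ! * l !)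
factorial-halves h l (inj₁ refl) = [l+l]!≤ l
factorial-halves h l (inj₂ refl) = [1+l+l]!≤ l

-- Strong induction on `x = h + l`: the primes up to `h` contribute at most `4 ^ h`, and those above
-- `h` at most the binomial coefficient, hence at most `4 ^ l`.
primorial≤4^ : ∀ b x → x < b → primorial b x ≤ 4 ^ x
primorial≤4^ b = <-rec (λ x → x < b → primorial b x ≤ 4 ^ x) step
  where
  step : ∀ x → (∀ {y} → y < x → y < b → primorial b y ≤ 4 ^ y) → x < b → primorial b x ≤ 4 ^ x
  step x rec x<b with x ≤? 1
  ... | yes x≤1 = begin
    primorial b x ≡⟨ ∏ᵖ-cong b (λ pp → ⟦⟧-false (<⇒≱ (≤-<-trans x≤1 (prime⇒2≤ pp)))) ⟩
    ∏ᵖ b (λ _ → 0) ≡⟨ ∏ᵖ-0 b ⟩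
    1             ≤⟨ m^n>0 4 x ⟩
    4 ^ x         ∎
    where open ≤-Reasoning
  ... | no x≰1 with halves x
  ...   | h , l , refl , near = *-cancelˡ-≤ (h ! * l !) {{h !* l !≢0}} (begin
    h ! * l ! * primorial b (h + l)      ≤⟨ primorial-halves b h l (l≤h near) x<b ⟩
    (h + l) ! * primorial b h            ≤⟨ *-mono-≤ (factorial-halves h l near) (rec h<x (<-trans h<x x<b)) ⟩
    4 ^ l * (h ! * l !) * 4 ^ h          ≡⟨ shuffle (4 ^ l) (h ! * l !) (4 ^ h) ⟩
    h ! * l ! * (4 ^ h * 4 ^ l)          ≡⟨ cong (h ! * l ! *_) (^-distribˡ-+-* 4 h l) ⟨
    h ! * l ! * 4 ^ (h + l)              ∎)
    where
    open ≤-Reasoning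
    shuffle : ∀ a c d → a * c * d ≡ c * (d * a)
    shuffle = solve-∀
    l≤h : ∀ {h l} → h ≡ l ⊎ h ≡ suc l → l ≤ h
    l≤h (inj₁ refl) = ≤-refl
    l≤h (inj₂ refl) = n≤1+n _
    -- `l = 0` would force `h + l ≤ 1`; past the base case `h` is therefore smaller than `x`.
    1≤l : ∀ {h l} → h ≡ l ⊎ h ≡ suc l → ¬ h + l ≤ 1 → 1 ≤ l
    1≤l {l = zero} (inj₁ refl) big = contradiction z≤n big
    1≤l {l = zero} (inj₂ refl) big = contradiction ≤-refl big
    1≤l {l = suc _} _ _ = s≤s z≤n
    h<x : h < h + l
    h<x = m<m+n h (1≤l near x≰1)

-- Factorial quotients: a list of divisors d of m stands for the product of the (m q / d) !, because
-- then ⌊(m q / d) / k⌋ = ⌊⌊m q / k⌋ / d⌋ depends on ⌊m q / k⌋ only.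

floors : List ℕ → ℕ → ℕ
floors ds w = sum (map (w ÷_) ds)

factorials : ℕ → ℕ → List ℕ → ℕ
factorials m q ds = product (map (λ d → (m ÷ d * q) !) ds)

-- The exponential growth rate of `factorials m q ds`, which equals `selfPowers m ds ^ q * (q !) ^
-- floors ds m` up to a factor polynomial in `q`. The ratio of the rates of the two lists is the κ
-- of the introduction.
selfPowers : ℕ → List ℕ → ℕ
selfPowers m ds = product (map (λ d → (m ÷ d) ^ (m ÷ d)) ds)

÷-≤ : ∀ m d → m ÷ d ≤ m
÷-≤ m zero    = z≤n
÷-≤ m (suc d) = m/n≤m m (suc d)

∣⇒*÷ : ∀ {m d} .{{_ : NonZero m}} → d ∣ m → 1 ≤ d × d * (m ÷ d) ≡ m
∣⇒*÷ {m} {zero}  0∣m = contradiction (0∣⇒≡0 0∣m) (≢-nonZero⁻¹ m)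
∣⇒*÷ {m} {suc d} d∣m = s≤s z≤n , m*[n/m]≡n d∣m

factorials-legendre : ∀ b m q ds .{{_ : NonZero m}} → m * q < b → All (_∣ m) ds →
  factorials m q ds ≡ ∏ᵖ b (λ p → ∑ b (λ j → floors ds (m * q ÷ p ^ suc j)))
factorials-legendre b m q [] _ [] = sym (trans (∏ᵖ-cong b λ _ → ∑-0 b) (∏ᵖ-0 b))
factorials-legendre b m q (d ∷ ds) mq<b (d∣m ∷ ds∣m) = begin
  (m ÷ d * q) ! * factorials m q ds
    ≡⟨ cong₂ _*_ (legendre b (m ÷ d * q) (≤-<-trans (*-monoˡ-≤ q (÷-≤ m d)) mq<b))
                 (factorials-legendre b m q ds mq<b ds∣m) ⟩
  ∏ᵖ b (λ p → ∑ b (λ j → (m ÷ d * q) ÷ p ^ suc j)) * ∏ᵖ b (λ p → ∑ b (λ j → floors ds (m * q ÷ p ^ suc j)))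
    ≡⟨ ∏ᵖ-+ b _ _ ⟨
  ∏ᵖ b (λ p → ∑ b (λ j → (m ÷ d * q) ÷ p ^ suc j) + ∑ b (λ j → floors ds (m * q ÷ p ^ suc j)))
    ≡⟨ ∏ᵖ-cong b (λ {p} pp → trans (cong (_+ ∑ b (λ j → floors ds (m * q ÷ p ^ suc j))) (∑-cong b (nested pp)))
                                   (sym (∑-+ b _ _))) ⟩
  ∏ᵖ b (λ p → ∑ b (λ j → floors (d ∷ ds) (m * q ÷ p ^ suc j))) ∎
  where
  open ≡-Reasoning
  nested : ∀ {p} → Prime p → ∀ j → (m ÷ d * q) ÷ p ^ suc j ≡ m * q ÷ p ^ suc j ÷ d
  nested {p} pp j with ∣⇒*÷ {m} d∣m
  ... | 1≤d , eq = trans (÷-÷ (m ÷ d) d q (p ^ suc j) (1≤p^ (suc j) pp) 1≤d)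
                         (cong (λ n → n * q ÷ p ^ suc j ÷ d) eq)

floors-periodic : ∀ m ds u c .{{_ : NonZero m}} → All (_∣ m) ds →
                  floors ds (u + c * m) ≡ floors ds u + c * floors ds m
floors-periodic m [] u c [] = sym (*-zeroʳ c)
floors-periodic m (d ∷ ds) u c (d∣m ∷ ds∣m) with ∣⇒*÷ {m} d∣m
... | 1≤d , eq = begin
  (u + c * m) ÷ d + floors ds (u + c * m)
    ≡⟨ cong₂ _+_ step (floors-periodic m ds u c ds∣m) ⟩
  u ÷ d + c * (m ÷ d) + (floors ds u + c * floors ds m)
    ≡⟨ shuffle (u ÷ d) c (m ÷ d) (floors ds u) (floors ds m) ⟩
  u ÷ d + floors ds u + c * (m ÷ d + floors ds m) ∎
  where
  open ≡-Reasoning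
  shuffle : ∀ x c y z t → x + c * y + (z + c * t) ≡ x + z + c * (y + t)
  shuffle = solve-∀
  shuffle′ : ∀ c d e → c * (d * e) ≡ c * e * d
  shuffle′ = solve-∀
  step : (u + c * m) ÷ d ≡ u ÷ d + c * (m ÷ d)
  step = trans (cong (λ n → (u + n) ÷ d) (trans (cong (c *_) (sym eq)) (shuffle′ c d (m ÷ d))))
               (÷-+* u (c * (m ÷ d)) d {{>-nonZero 1≤d}})

-- Equal values at `m` make the difference of the two floor sums periodic with period `m`, which
-- reduces the inequality to a finite check.
floors-≤-periodic : ∀ m ps qs .{{_ : NonZero m}} → All (_∣ m) ps → All (_∣ m) qs →
  floors ps m ≡ floors qs m → (∀ {w} → w < m → floors ps w ≤ suc (floors qs w)) →
  ∀ w → floors ps w ≤ suc (floors qs w)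
floors-≤-periodic m ps qs ps∣m qs∣m eq le w = begin
  floors ps w                                     ≡⟨ cong (floors ps) (m≡m%n+[m/n]*n w m) ⟩
  floors ps (w % m + w / m * m)                   ≡⟨ floors-periodic m ps (w % m) (w / m) ps∣m ⟩
  floors ps (w % m) + w / m * floors ps m         ≤⟨ +-mono-≤ (le (m%n<n w m)) (≤-reflexive (cong (w / m *_) eq)) ⟩
  suc (floors qs (w % m)) + w / m * floors qs m   ≡⟨ cong suc (floors-periodic m qs (w % m) (w / m) qs∣m) ⟨
  suc (floors qs (w % m + w / m * m))             ≡⟨ cong (suc ∘ floors qs) (m≡m%n+[m/n]*n w m) ⟨
  suc (floors qs w)                               ∎
  where open ≤-Reasoning

-- Upper bound for a factorial quotient when the interval has no prime

powersUpTo : ℕ → ℕ → ℕ → ℕ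
powersUpTo b p y = ∑ b (λ j → ⟦ p ^ suc j ≤? y ⟧)

-- Descend from the largest exponent: at the first one with `p ^ suc b ≤ y`, at most `suc b` powers
-- are counted.
p^powersUpTo≤y : ∀ b p y → 1 ≤ p → 1 ≤ y → p ^ powersUpTo b p y ≤ y
p^powersUpTo≤y zero    p y 1≤p 1≤y = 1≤y
p^powersUpTo≤y (suc b) p y 1≤p 1≤y with p ^ suc b ≤? y
... | yes le = ≤-trans (^-monoʳ 1≤p (≤-trans (≤-reflexive (+-comm _ 1)) (s≤s (count b)))) le
  where
  ⟦⟧≤1 : ∀ {A : Set} (d : Dec A) → ⟦ d ⟧ ≤ 1
  ⟦⟧≤1 (yes _) = ≤-refl
  ⟦⟧≤1 (no _)  = z≤n
  count : ∀ b → powersUpTo b p y ≤ b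
  count zero    = z≤n
  count (suc b) = ≤-trans (+-mono-≤ (count b) (⟦⟧≤1 (p ^ suc b ≤? y))) (≤-reflexive (+-comm b 1))
... | no _ = ≤-trans (≤-reflexive (cong (p ^_) (+-identityʳ (powersUpTo b p y)))) (p^powersUpTo≤y b p y 1≤p 1≤y)

-- p ^ j > c q means ⌊m q / p ^ j⌋ < 7, e q < p ^ j ≤ c q means it is 7, and p ^ j > t q means it is < u.
factorials-≤ : ∀ m c e t u ps qs q r .{{_ : NonZero m}} .{{_ : NonZero c}} .{{_ : NonZero q}} →
  All (_∣ m) ps → All (_∣ m) qs → m ≡ 7 * c → m ≡ 8 * e → m ≡ u * t → t ≤ m → 7 ≤ u →
  (∀ w → floors ps w ≤ suc (floors qs w)) →
  (∀ {w} → w < u → w ≢ 7 → floors ps w ≤ floors qs w) →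
  c * q < suc r * suc r → (∀ {p} → Prime p → e * q < p → ¬ p ≤ c * q) →
  factorials m q ps ≤ factorials m q qs * ((c * q) ^ suc r * 4 ^ (t * q))
factorials-≤ m c e t u ps qs q r ps∣ qs∣ m≡7c m≡8e m≡ut t≤m 7≤u small tiny y<r² gap = begin
  factorials m q ps
    ≡⟨ factorials-legendre b m q ps ≤-refl ps∣ ⟩
  ∏ᵖ b (λ p → ∑ b (λ j → floors ps (w p (suc j))))
    ≤⟨ ∏ᵖ-mono b exponents ⟩
  ∏ᵖ b (λ p → ∑ b (λ j → floors qs (w p (suc j))) + (powers p + ⟦ p ≤? t * q ⟧))
    ≡⟨ trans (∏ᵖ-+ b _ _) (cong (∏ᵖ b (λ p → ∑ b (λ j → floors qs (w p (suc j)))) *_) (∏ᵖ-+ b _ _)) ⟩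
  ∏ᵖ b (λ p → ∑ b (λ j → floors qs (w p (suc j)))) * (∏ᵖ b powers * primorial b (t * q))
    ≤⟨ *-mono-≤ (≤-reflexive (sym (factorials-legendre b m q qs ≤-refl qs∣)))
         (*-mono-≤ (∏ᵖ-bounded b r 1≤y powers-small powers-vanish)
                   (primorial≤4^ b (t * q) (s≤s (*-monoˡ-≤ q t≤m)))) ⟩
  factorials m q qs * (y ^ suc r * 4 ^ (t * q)) ∎
  where
  open ≤-Reasoning
  y = c * q
  b = suc (m * q)
  w : ℕ → ℕ → ℕ
  w p j = m * q ÷ p ^ j
  powers : ℕ → ℕ
  -- A prime up to `r`, about √y, may have an excess of 1 at every power up to `y`. A larger prime
  -- can have one only at its first power, and only if `p ≤ t * q`; the primorial pays for it.
  powers p = ⟦ p ≤? r ⟧ * powersUpTo b p y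

  1≤y : 1 ≤ y
  1≤y = >-nonZero⁻¹ y {{m*n≢0 c q}}

  powers-small : ∀ {p} → Prime p → p ^ powers p ≤ y
  powers-small {p} pp with p ≤? r
  ... | yes _ = ≤-trans (≤-reflexive (cong (p ^_) (+-identityʳ (powersUpTo b p y)))) (p^powersUpTo≤y b p y (prime⇒1≤ pp) 1≤y)
  ... | no _  = 1≤y

  powers-vanish : ∀ p → r < p → powers p ≡ 0
  powers-vanish p r<p = cong (_* powersUpTo b p y) (⟦⟧-false {d = p ≤? r} (<⇒≱ r<p))

  ÷-< : ∀ c k → m * q < c * k → m * q ÷ k < c
  ÷-< c zero  lt = contradiction (subst (m * q <_) (*-zeroʳ c) lt) λ ()
  ÷-< c (suc k) lt = m<n*o⇒m/o<n lt

  ÷-≥ : ∀ c k → 1 ≤ k → c * k ≤ m * q → c ≤ m * q ÷ k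
  ÷-≥ c k@(suc _) _ le = ≤-trans (≤-reflexive (sym (m*n/n≡m c k))) (/-monoˡ-≤ k le)

  split : ∀ a b → m ≡ a * b → m * q ≡ a * (b * q)
  split a b eq = trans (cong (_* q) eq) (*-assoc a b q)

  beyond : ∀ k → y < k → m * q ÷ k < 7
  beyond k y<k = ÷-< 7 k (≤-<-trans (≤-reflexive (split 7 c m≡7c)) (*-monoʳ-< 7 y<k))

  large : ∀ {k} → y < k → floors ps (m * q ÷ k) ≤ floors qs (m * q ÷ k)
  large {k} y<k = tiny (<-≤-trans (beyond k y<k) 7≤u) (<⇒≢ (beyond k y<k))

  square : ∀ {p} j → Prime p → r < p → y < p ^ suc (suc j)
  square {p} j pp r<p = begin-strict
    y               <⟨ y<r² ⟩
    suc r * suc r   ≤⟨ *-mono-≤ r<p r<p ⟩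
    p * p           ≤⟨ *-monoʳ-≤ p (m≤m*n p (p ^ j) {{>-nonZero (1≤p^ j pp)}}) ⟩
    p ^ suc (suc j) ∎

  medium : ∀ {p} → Prime p → t * q < p → floors ps (w p 1) ≤ floors qs (w p 1)
  medium {p} pp tq<p rewrite *-identityʳ p with p ≤? y | p ≤? e * q
  ... | no p≰y  | _ = large (≰⇒> p≰y)
  ... | yes p≤y | no p≰  = contradiction p≤y (gap pp (≰⇒> p≰))
  -- `t * q < p` puts the quotient below `u`, and `p ≤ e * q` makes it at least 8, so it avoids the
  -- exceptional value 7.
  ... | yes _   | yes p≤ = tiny (÷-< u p (≤-<-trans (≤-reflexive (split u t m≡ut)) (*-monoʳ-< u {{>-nonZero (≤-trans (s≤s z≤n) 7≤u)}} tq<p)))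
    (<⇒≢ (÷-≥ 8 p (prime⇒1≤ pp) (≤-trans (*-monoʳ-≤ 8 p≤) (≤-reflexive (sym (split 8 e m≡8e))))) ∘ sym)

  first : ∀ {p} → Prime p → floors ps (w p 1) ≤ floors qs (w p 1) + ⟦ p ≤? t * q ⟧
  first {p} pp with p ≤? t * q
  ... | yes _ = ≤-trans (small (w p 1)) (≤-reflexive (+-comm 1 _))
  ... | no p≰ = ≤-trans (medium pp (≰⇒> p≰)) (m≤m+n _ 0)

  each : ∀ p j → floors ps (w p j) ≤ floors qs (w p j) + ⟦ p ^ j ≤? y ⟧
  each p j with p ^ j ≤? y
  ... | yes _ = ≤-trans (small (w p j)) (≤-reflexive (+-comm 1 _))
  ... | no p≰ = ≤-trans (large (≰⇒> p≰)) (m≤m+n _ 0)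

  shuffle : ∀ a c d → a + c + d ≡ a + d + c
  shuffle = solve-∀

  exponents : ∀ {p} → Prime p → ∑ b (λ j → floors ps (w p (suc j))) ≤
              ∑ b (λ j → floors qs (w p (suc j))) + (powers p + ⟦ p ≤? t * q ⟧)
  exponents {p} pp with p ≤? r
  ... | yes _ = begin
    ∑ b (λ j → floors ps (w p (suc j)))
      ≤⟨ ∑-mono b (λ j → each p (suc j)) ⟩
    ∑ b (λ j → floors qs (w p (suc j)) + ⟦ p ^ suc j ≤? y ⟧)
      ≡⟨ ∑-+ b _ _ ⟩
    ∑ b (λ j → floors qs (w p (suc j))) + powersUpTo b p y
      ≤⟨ +-monoʳ-≤ (∑ b (λ j → floors qs (w p (suc j)))) (≤-trans (m≤m+n _ 0) (m≤m+n _ _)) ⟩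
    ∑ b (λ j → floors qs (w p (suc j))) + (1 * powersUpTo b p y + ⟦ p ≤? t * q ⟧) ∎
  -- Here `p * p > y`, so all powers after the first are in the range without excess.
  ... | no p≰r = begin
    ∑ b (λ j → floors ps (w p (suc j)))
      ≡⟨ ∑-head (m * q) _ ⟩
    floors ps (w p 1) + ∑ (m * q) (λ j → floors ps (w p (suc (suc j))))
      ≤⟨ +-mono-≤ (first pp) (∑-mono (m * q) λ j → large (square j pp (≰⇒> p≰r))) ⟩
    floors qs (w p 1) + ⟦ p ≤? t * q ⟧ + ∑ (m * q) (λ j → floors qs (w p (suc (suc j))))
      ≡⟨ shuffle (floors qs (w p 1)) _ _ ⟩
    floors qs (w p 1) + ∑ (m * q) (λ j → floors qs (w p (suc (suc j)))) + ⟦ p ≤? t * q ⟧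
      ≡⟨ cong (_+ ⟦ p ≤? t * q ⟧) (∑-head (m * q) _) ⟨
    ∑ b (λ j → floors qs (w p (suc j))) + ⟦ p ≤? t * q ⟧ ∎

-- Growth of factorial quotients

^-distrib-* : ∀ m n k → (m * n) ^ k ≡ m ^ k * n ^ k
^-distrib-* m n zero    = refl
^-distrib-* m n (suc k) = trans (cong (m * n *_) (^-distrib-* m n k)) (shuffle m n (m ^ k) (n ^ k))
  where
  shuffle : ∀ a b c d → a * b * (c * d) ≡ a * c * (b * d)
  shuffle = solve-∀

-- Raising `q` by one adds `a` factors to the factorial, each at most `a * suc q`.
[a*q]!≤ : ∀ a q → (a * q) ! ≤ (a ^ a) ^ q * (q !) ^ a
[a*q]!≤ a zero rewrite *-zeroʳ a = ≤-reflexive (sym (trans (*-identityˡ _) (^-zeroˡ a)))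
[a*q]!≤ a (suc q) = begin
  (a * suc q) !                                  ≡⟨ cong _! (*-suc a q) ⟩
  (a + a * q) !                                  ≤⟨ [m+k]!≤m!*[m+k]^k (a * q) a ⟩
  (a * q) ! * (a + a * q) ^ a                    ≤⟨ *-monoˡ-≤ _ ([a*q]!≤ a q) ⟩
  (a ^ a) ^ q * (q !) ^ a * (a + a * q) ^ a      ≡⟨ cong (λ n → (a ^ a) ^ q * (q !) ^ a * n ^ a) (*-suc a q) ⟨
  (a ^ a) ^ q * (q !) ^ a * (a * suc q) ^ a      ≡⟨ cong ((a ^ a) ^ q * (q !) ^ a *_) (^-distrib-* a (suc q) a) ⟩
  (a ^ a) ^ q * (q !) ^ a * (a ^ a * suc q ^ a)  ≡⟨ shuffle ((a ^ a) ^ q) ((q !) ^ a) (a ^ a) (suc q ^ a) ⟩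
  a ^ a * (a ^ a) ^ q * (suc q ^ a * (q !) ^ a)  ≡⟨ cong (a ^ a * (a ^ a) ^ q *_) (^-distrib-* (suc q) (q !) a) ⟨
  a ^ a * (a ^ a) ^ q * (suc q * q !) ^ a        ∎
  where
  open ≤-Reasoning
  shuffle : ∀ a b c d → a * b * (c * d) ≡ c * a * (d * b)
  shuffle = solve-∀

-- The loss does not accumulate: the surplus `(a * q) ^ a` of one stage is absorbed by the next `a`
-- factors of the factorial, each at least `a * q`, leaving only the new surplus.
[a*q]!≥ : ∀ a q → (a ^ a) ^ suc q * (suc q !) ^ a ≤ (a * suc q) ! * (a * suc q) ^ a
[a*q]!≥ a zero rewrite *-identityʳ a | ^-zeroˡ a = begin
  a ^ a * 1 * 1   ≡⟨ trans (*-identityʳ _) (*-identityʳ _) ⟩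
  a ^ a           ≤⟨ m≤n*m (a ^ a) (a !) {{a !≢0}} ⟩
  a ! * a ^ a     ∎
  where open ≤-Reasoning
[a*q]!≥ a (suc q′) = begin
  a ^ a * (a ^ a) ^ q * (suc q * q !) ^ a          ≡⟨ cong (a ^ a * (a ^ a) ^ q *_) (^-distrib-* (suc q) (q !) a) ⟩
  a ^ a * (a ^ a) ^ q * (suc q ^ a * (q !) ^ a)    ≡⟨ shuffle (a ^ a) ((a ^ a) ^ q) (suc q ^ a) ((q !) ^ a) ⟩
  (a ^ a) ^ q * (q !) ^ a * (a ^ a * suc q ^ a)    ≤⟨ *-monoˡ-≤ _ ([a*q]!≥ a q′) ⟩
  (a * q) ! * (a * q) ^ a * (a ^ a * suc q ^ a)    ≤⟨ *-monoˡ-≤ _ (m!*m^k≤[m+k]! (a * q) a) ⟩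
  (a + a * q) ! * (a ^ a * suc q ^ a)              ≡⟨ cong₂ (λ u v → u ! * v) (*-suc a q) (^-distrib-* a (suc q) a) ⟨
  (a * suc q) ! * (a * suc q) ^ a                  ∎
  where
  open ≤-Reasoning
  q = suc q′
  shuffle : ∀ a b c d → a * b * (c * d) ≡ b * d * (a * c)
  shuffle = solve-∀

factorials-upper : ∀ m q ds → factorials m q ds ≤ selfPowers m ds ^ q * (q !) ^ floors ds m
factorials-upper m q [] = ≤-reflexive (sym (trans (*-identityʳ _) (^-zeroˡ q)))
factorials-upper m q (d ∷ ds) = begin
  (a * q) ! * factorials m q ds
    ≤⟨ *-mono-≤ ([a*q]!≤ a q) (factorials-upper m q ds) ⟩
  (a ^ a) ^ q * (q !) ^ a * (selfPowers m ds ^ q * (q !) ^ floors ds m)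
    ≡⟨ shuffle ((a ^ a) ^ q) _ _ _ ⟩
  (a ^ a) ^ q * selfPowers m ds ^ q * ((q !) ^ a * (q !) ^ floors ds m)
    ≡⟨ cong₂ _*_ (^-distrib-* (a ^ a) (selfPowers m ds) q) (^-distribˡ-+-* (q !) a (floors ds m)) ⟨
  (a ^ a * selfPowers m ds) ^ q * (q !) ^ (a + floors ds m) ∎
  where
  open ≤-Reasoning
  a = m ÷ d
  shuffle : ∀ a b c d → a * b * (c * d) ≡ a * c * (b * d)
  shuffle = solve-∀

factorials-lower : ∀ m q c ds .{{_ : NonZero q}} → All (λ d → m ÷ d ≤ c) ds →
  selfPowers m ds ^ q * (q !) ^ floors ds m ≤ factorials m q ds * (c * q) ^ floors ds m
factorials-lower m q c [] [] = ≤-reflexive (cong (_* 1) (^-zeroˡ q))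
factorials-lower m q@(suc q′) c (d ∷ ds) (a≤c ∷ as≤c) = begin
  (a ^ a * selfPowers m ds) ^ q * (q !) ^ (a + floors ds m)
    ≡⟨ cong₂ _*_ (^-distrib-* (a ^ a) (selfPowers m ds) q) (^-distribˡ-+-* (q !) a (floors ds m)) ⟩
  (a ^ a) ^ q * selfPowers m ds ^ q * ((q !) ^ a * (q !) ^ floors ds m)
    ≡⟨ shuffle ((a ^ a) ^ q) _ _ _ ⟩
  (a ^ a) ^ q * (q !) ^ a * (selfPowers m ds ^ q * (q !) ^ floors ds m)
    ≤⟨ *-mono-≤ ([a*q]!≥ a q′) (factorials-lower m q c ds as≤c) ⟩
  (a * q) ! * (a * q) ^ a * (factorials m q ds * (c * q) ^ floors ds m)
    ≤⟨ *-monoˡ-≤ _ (*-monoʳ-≤ ((a * q) !) (^-monoˡ-≤ a (*-monoˡ-≤ q a≤c))) ⟩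
  (a * q) ! * (c * q) ^ a * (factorials m q ds * (c * q) ^ floors ds m)
    ≡⟨ shuffle ((a * q) !) _ _ _ ⟩
  (a * q) ! * factorials m q ds * ((c * q) ^ a * (c * q) ^ floors ds m)
    ≡⟨ cong ((a * q) ! * factorials m q ds *_) (^-distribˡ-+-* (c * q) a (floors ds m)) ⟨
  (a * q) ! * factorials m q ds * (c * q) ^ (a + floors ds m) ∎
  where
  open ≤-Reasoning
  a = m ÷ d
  shuffle : ∀ a b c d → a * b * (c * d) ≡ a * c * (b * d)
  shuffle = solve-∀

selfPowers≥1 : ∀ m ds → 1 ≤ selfPowers m ds
selfPowers≥1 m []       = ≤-refl
selfPowers≥1 m (d ∷ ds) = *-mono-≤ (n^n≥1 (m ÷ d)) (selfPowers≥1 m ds)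
  where
  n^n≥1 : ∀ n → 1 ≤ n ^ n
  n^n≥1 zero    = ≤-refl
  n^n≥1 (suc n) = m^n>0 (suc n) (suc n)

-- Since both lists have the same sum `s`, the powers of `q !` cancel. What remains is the growth
-- `g ^ q` against the polynomial loss `(c * q) ^ s` and the assumed bound `z` on the quotient.
factorials-growth : ∀ m c g s z ps qs q .{{_ : NonZero q}} → All (λ d → m ÷ d ≤ c) ps →
  floors ps m ≡ s → floors qs m ≡ s → selfPowers m qs * g ≤ selfPowers m ps →
  factorials m q ps ≤ factorials m q qs * z → g ^ q ≤ (c * q) ^ s * z
factorials-growth m c g s z ps qs q ps≤c ps≡s qs≡s gap bound =
  *-cancelˡ-≤ k {{>-nonZero 1≤k}} (begin
    selfPowers m qs ^ q * (q !) ^ s * g ^ q   ≡⟨ shuffle (selfPowers m qs ^ q) _ _ ⟩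
    selfPowers m qs ^ q * g ^ q * (q !) ^ s   ≡⟨ cong (_* (q !) ^ s) (^-distrib-* (selfPowers m qs) g q) ⟨
    (selfPowers m qs * g) ^ q * (q !) ^ s     ≤⟨ *-monoˡ-≤ ((q !) ^ s) (^-monoˡ-≤ q gap) ⟩
    selfPowers m ps ^ q * (q !) ^ s           ≤⟨ lower ⟩
    factorials m q ps * (c * q) ^ s           ≤⟨ *-monoˡ-≤ ((c * q) ^ s) bound ⟩
    factorials m q qs * z * (c * q) ^ s       ≤⟨ *-monoˡ-≤ ((c * q) ^ s) (*-monoˡ-≤ z upper) ⟩
    k * z * (c * q) ^ s                       ≡⟨ shuffle′ k z _ ⟩
    k * ((c * q) ^ s * z)                     ∎)
  where
  open ≤-Reasoning
  k = selfPowers m qs ^ q * (q !) ^ s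
  lower : selfPowers m ps ^ q * (q !) ^ s ≤ factorials m q ps * (c * q) ^ s
  lower = subst (λ s → selfPowers m ps ^ q * (q !) ^ s ≤ factorials m q ps * (c * q) ^ s) ps≡s
            (factorials-lower m q c ps ps≤c)
  upper : factorials m q qs ≤ k
  upper = subst (λ s → factorials m q qs ≤ selfPowers m qs ^ q * (q !) ^ s) qs≡s (factorials-upper m q qs)
  1≤k : 1 ≤ k
  1≤k = *-mono-≤ (m^n>0 _ {{>-nonZero (selfPowers≥1 m qs)}} q) (m^n>0 _ {{q !≢0}} s)
  shuffle : ∀ a b c → a * b * c ≡ a * c * b
  shuffle = solve-∀
  shuffle′ : ∀ a b c → a * b * c ≡ a * (c * b)
  shuffle′ = solve-∀

cancel-4^ : ∀ k t q y s → (2 ^ k * 4 ^ t) ^ q ≤ y ^ s * 4 ^ (t * q) → 2 ^ (k * q) ≤ y ^ s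
cancel-4^ k t q y s le = *-cancelʳ-≤ (2 ^ (k * q)) (y ^ s) (4 ^ (t * q)) {{m^n≢0 4 (t * q)}} (begin
  2 ^ (k * q) * 4 ^ (t * q)        ≡⟨ cong₂ _*_ (^-*-assoc 2 k q) (^-*-assoc 4 t q) ⟨
  (2 ^ k) ^ q * (4 ^ t) ^ q        ≡⟨ ^-distrib-* (2 ^ k) (4 ^ t) q ⟨
  (2 ^ k * 4 ^ t) ^ q              ≤⟨ le ⟩
  y ^ s * 4 ^ (t * q)              ∎)
  where open ≤-Reasoning

-- Integer roots and logarithms

sqrt : ∀ n → ∃[ r ] (r * r ≤ n × n < suc r * suc r)
sqrt zero = 0 , z≤n , s≤s z≤n
sqrt (suc n) with sqrt n
... | r , r²≤n , n<r² with suc r * suc r ≤? suc n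
...   | yes le = suc r , le , (begin-strict
    suc n                     ≤⟨ n<r² ⟩
    suc r * suc r             <⟨ *-mono-< (n<1+n (suc r)) (n<1+n (suc r)) ⟩
    suc (suc r) * suc (suc r) ∎)
  where open ≤-Reasoning
...   | no ≰ = r , m≤n⇒m≤1+n r²≤n , ≰⇒> ≰

√-≥ : ∀ a {y} r → a * a ≤ y → y < suc r * suc r → a ≤ suc r
√-≥ a r a²≤y y<r² = ≮⇒≥ λ r<a → <⇒≱ y<r² (≤-trans (*-mono-≤ (<⇒≤ r<a) (<⇒≤ r<a)) a²≤y)

log₂ : ∀ n → 1 ≤ n → ∃[ t ] (2 ^ t ≤ n × n < 2 ^ suc t)
log₂ (suc zero) _ = 0 , s≤s z≤n , s≤s (s≤s z≤n)
log₂ (suc n@(suc _)) _ with log₂ n (s≤s z≤n)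
... | t , lo , hi with 2 ^ suc t ≤? suc n
...   | yes le = suc t , le , ≤-<-trans hi (^-monoʳ-< 2 (s≤s (s≤s z≤n)) (n<1+n (suc t)))
...   | no ≰ = t , m≤n⇒m≤1+n lo , ≰⇒> ≰

linear≤exponential : ∀ c n₀ t₀ s → c * suc n₀ ≤ 2 ^ t₀ → c * (suc n₀ + s) ≤ 2 ^ (t₀ + s)
linear≤exponential c n₀ t₀ zero    base rewrite +-identityʳ n₀ | +-identityʳ t₀ = base
linear≤exponential c n₀ t₀ (suc s) base = begin
  c * (suc n₀ + suc s)              ≡⟨ cong (c *_) (+-suc (suc n₀) s) ⟩
  c * (1 + (suc n₀ + s))            ≡⟨ *-distribˡ-+ c 1 (suc n₀ + s) ⟩
  c * 1 + c * (suc n₀ + s)          ≤⟨ +-mono-≤ (≤-trans (*-monoʳ-≤ c (s≤s z≤n)) rec) (≤-trans rec (m≤m+n _ 0)) ⟩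
  2 * 2 ^ (t₀ + s)                  ≡⟨ cong (2 ^_) (+-suc t₀ s) ⟨
  2 ^ (t₀ + suc s)                  ∎
  where
  open ≤-Reasoning
  rec = linear≤exponential c n₀ t₀ s base

-- With 2 ^ (t - 1) ≤ n < 2 ^ t, it suffices that c t ≤ 2 ^ (t - 1); this persists from `t₀` on, as
-- each step at most doubles the left side and doubles the right.
log-small : ∀ c t₀ n → c * suc t₀ ≤ 2 ^ t₀ → 2 ^ t₀ ≤ n → ∃[ t ] (n < 2 ^ t × c * t ≤ n)
log-small c t₀ n base big with log₂ n (≤-trans (m^n>0 2 t₀) big)
... | t , lo , hi = suc t , hi ,
  ≤-trans (subst (λ t → c * suc t ≤ 2 ^ t) (m+[n∸m]≡n t₀≤t) (linear≤exponential c t₀ t₀ (t ∸ t₀) base)) lo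
  where
  t₀≤t : t₀ ≤ t
  t₀≤t = ≮⇒≥ λ t<t₀ → <⇒≱ hi (≤-trans (^-monoʳ-≤ 2 t<t₀) big)

quadratic : ∀ s r → 3 + s ≤ r → suc r * (s + suc r) < 2 * (r * r)
quadratic s r le = begin-strict
  suc r * (s + suc r)              ≡⟨ expand s r ⟩
  r * r + ((2 + s) * r + suc s)    <⟨ +-monoʳ-< (r * r) (+-monoʳ-< ((2 + s) * r) (≤-trans (n≤1+n _) le)) ⟩
  r * r + ((2 + s) * r + r)        ≡⟨ cong (r * r +_) (+-comm _ r) ⟩
  r * r + (3 + s) * r              ≤⟨ +-monoʳ-≤ (r * r) (*-monoˡ-≤ r le) ⟩
  r * r + r * r                    ≡⟨ cong (r * r +_) (+-identityʳ (r * r)) ⟨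
  2 * (r * r)                      ∎
  where
  open ≤-Reasoning
  expand : ∀ s r → suc r * (s + suc r) ≡ r * r + ((2 + s) * r + suc s)
  expand = solve-∀

-- From `c * q ≤ 2 ^ (t + t)`, base-2 logarithms of the negated inequality give
-- `k * q ≤ (t + t) * (s + suc r)`. Multiplying by `g` bounds `2 * (r * r)` by
-- `suc r * (s + suc r)`, contradicting `quadratic`.
exponential-beats : ∀ c k g q r s t → 2 * c ≡ g * k → r * r ≤ c * q → c * q < suc r * suc r →
                    suc r < 2 ^ t → (g + g) * t ≤ suc r → 3 + s ≤ r →
                    ¬ 2 ^ (k * q) ≤ (c * q) ^ (s + suc r)
exponential-beats c k g q r s t 2c≡gk lo hi r<2^t t-small s≤r le = <⇒≱ (quadratic s r s≤r) (begin
  2 * (r * r)                        ≤⟨ *-monoʳ-≤ 2 lo ⟩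
  2 * (c * q)                        ≡⟨ *-assoc 2 c q ⟨
  2 * c * q                          ≡⟨ cong (_* q) 2c≡gk ⟩
  g * k * q                          ≡⟨ *-assoc g k q ⟩
  g * (k * q)                        ≤⟨ *-monoʳ-≤ g kq≤ ⟩
  g * ((t + t) * (s + suc r))        ≡⟨ regroup g t (s + suc r) ⟩
  (g + g) * t * (s + suc r)          ≤⟨ *-monoˡ-≤ (s + suc r) t-small ⟩
  suc r * (s + suc r)                ∎)
  where
  open ≤-Reasoning
  regroup : ∀ g t n → g * ((t + t) * n) ≡ (g + g) * t * n
  regroup = solve-∀
  y≤ : c * q ≤ 2 ^ (t + t)
  y≤ = ≤-trans (<⇒≤ hi) (≤-trans (*-mono-≤ (<⇒≤ r<2^t) (<⇒≤ r<2^t)) (≤-reflexive (sym (^-distribˡ-+-* 2 t t))))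
  kq≤ : k * q ≤ (t + t) * (s + suc r)
  kq≤ = ≮⇒≥ λ lt → <⇒≱ (^-monoʳ-< 2 (s≤s (s≤s z≤n)) lt)
    (≤-trans le (≤-trans (^-monoˡ-≤ (s + suc r) y≤) (≤-reflexive (^-*-assoc 2 (t + t) (s + suc r)))))

-- A prime between `e * q` and `c * q`

no-prime⇒2^≤ : ∀ m c e t u k s ps qs q r .{{_ : NonZero m}} .{{_ : NonZero c}} .{{_ : NonZero q}} →
  All (_∣ m) ps → All (_∣ m) qs → m ≡ 7 * c → m ≡ 8 * e → m ≡ u * t → t ≤ m → 7 ≤ u →
  (∀ w → floors ps w ≤ suc (floors qs w)) →
  (∀ {w} → w < u → w ≢ 7 → floors ps w ≤ floors qs w) →
  All (λ d → m ÷ d ≤ c) ps → floors ps m ≡ s → floors qs m ≡ s →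
  selfPowers m qs * (2 ^ k * 4 ^ t) ≤ selfPowers m ps →
  c * q < suc r * suc r → (∀ {p} → Prime p → e * q < p → ¬ p ≤ c * q) →
  2 ^ (k * q) ≤ (c * q) ^ (s + suc r)
no-prime⇒2^≤ m c e t u k s ps qs q r ps∣ qs∣ m≡7c m≡8e m≡ut t≤m 7≤u small tiny ps≤c ps≡s qs≡s gap y<r² none =
  cancel-4^ k t q (c * q) (s + suc r) (≤-trans
    (factorials-growth m c (2 ^ k * 4 ^ t) s ((c * q) ^ suc r * 4 ^ (t * q)) ps qs q ps≤c ps≡s qs≡s gap
      (factorials-≤ m c e t u ps qs q r ps∣ qs∣ m≡7c m≡8e m≡ut t≤m 7≤u small tiny y<r² none))
    (≤-reflexive regroup))
  where
  regroup : (c * q) ^ s * ((c * q) ^ suc r * 4 ^ (t * q)) ≡ (c * q) ^ (s + suc r) * 4 ^ (t * q)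
  regroup = trans (sym (*-assoc ((c * q) ^ s) ((c * q) ^ suc r) (4 ^ (t * q))))
                  (cong (_* 4 ^ (t * q)) (sym (^-distribˡ-+-* (c * q) s (suc r))))

-- A bounded search finds the prime or proves its absence, and absence contradicts
-- `exponential-beats`. The threshold `2 ^ t₀ ≤ suc r` is what makes both the logarithm of `suc r`
-- and the constant `s` small enough relative to `r`.
prime-between : ∀ m c e t u k g s t₀ ps qs .{{_ : NonZero m}} .{{_ : NonZero c}} →
  All (_∣ m) ps → All (_∣ m) qs → m ≡ 7 * c → m ≡ 8 * e → m ≡ u * t → t ≤ m → 7 ≤ u →
  (∀ w → floors ps w ≤ suc (floors qs w)) →
  (∀ {w} → w < u → w ≢ 7 → floors ps w ≤ floors qs w) →
  All (λ d → m ÷ d ≤ c) ps → floors ps m ≡ s → floors qs m ≡ s →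
  selfPowers m qs * (2 ^ k * 4 ^ t) ≤ selfPowers m ps →
  2 * c ≡ g * k → (g + g) * suc t₀ ≤ 2 ^ t₀ → 4 + s ≤ 2 ^ t₀ →
  ∀ q .{{_ : NonZero q}} → 2 ^ t₀ * 2 ^ t₀ ≤ c * q → ∃[ p ] (Prime p × e * q < p × p ≤ c * q)
prime-between m c e t u k g s t₀ ps qs ps∣ qs∣ m≡7c m≡8e m≡ut t≤m 7≤u small tiny ps≤c ps≡s qs≡s gap 2c≡gk base s-small q big
  with anyUpTo? (λ p → prime? p ×-dec e * q <? p) (suc (c * q))
... | yes (p , p<1+y , pp , lt) = p , pp , lt , s≤s⁻¹ p<1+y
... | no none with sqrt (c * q)
...   | r , r²≤y , y<r² with √-≥ (2 ^ t₀) r big y<r²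
...     | large with log-small (g + g) t₀ (suc r) base large
...       | j , r<2^j , j-small = contradiction
  (no-prime⇒2^≤ m c e t u k s ps qs q r ps∣ qs∣ m≡7c m≡8e m≡ut t≤m 7≤u small tiny ps≤c ps≡s qs≡s gap
    y<r² λ {p} pp lt le → none (p , s≤s le , pp , lt))
  (exponential-beats c k g q r s j 2c≡gk r²≤y y<r² r<2^j j-small (s≤s⁻¹ (≤-trans s-small large)))

-- The quotient with `m = 1680`

-- The two lists were found by linear programming; the quotients 1680 / d sum to 566 in both.
numerator : List ℕ
numerator = 7 ∷ 16 ∷ 24 ∷ 40 ∷ 56 ∷ 84 ∷ 105 ∷ 140 ∷ 140 ∷ 240 ∷ 336 ∷ 560 ∷ 840 ∷ 840 ∷ []

denominator : List ℕ
denominator = 8 ∷ 14 ∷ 21 ∷ 35 ∷ 48 ∷ 80 ∷ 112 ∷ 120 ∷ 168 ∷ 280 ∷ 280 ∷ 1680 ∷ []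

numerator∣1680 : All (_∣ 1680) numerator
numerator∣1680 = from-yes (all? (_∣? 1680) numerator)

denominator∣1680 : All (_∣ 1680) denominator
denominator∣1680 = from-yes (all? (_∣? 1680) denominator)

floors-excess≤1 : ∀ w → floors numerator w ≤ suc (floors denominator w)
floors-excess≤1 = floors-≤-periodic 1680 numerator denominator numerator∣1680 denominator∣1680 refl
  (from-yes (allUpTo? (λ w → floors numerator w ≤? suc (floors denominator w)) 1680))

floors-no-excess : ∀ {w} → w < 560 → w ≢ 7 → floors numerator w ≤ floors denominator w
floors-no-excess = from-yes (allUpTo? (λ w → ¬? (w ≟ 7) →-dec (floors numerator w ≤? floors denominator w)) 560)

-- The factor `4 ^ 3` pays for the primes up to `3 * q`; `2 ^ 5` is the growth left to beat
-- `(240 * q) ^ (566 + suc r)`.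
selfPowers-gap : selfPowers 1680 denominator * (2 ^ 5 * 4 ^ 3) ≤ selfPowers 1680 numerator
selfPowers-gap = ≤ᵇ⇒≤ (selfPowers 1680 denominator * (2 ^ 5 * 4 ^ 3)) (selfPowers 1680 numerator) tt

numerator-≤ : All (λ d → 1680 ÷ d ≤ 240) numerator
numerator-≤ = from-yes (all? (λ d → 1680 ÷ d ≤? 240) numerator)

prime-in-gap : ∀ q .{{_ : NonZero q}} → 2 ^ 12 * 2 ^ 12 ≤ 240 * q →
               ∃[ p ] (Prime p × 210 * q < p × p ≤ 240 * q)
-- 1680 = 7 · 240 = 8 · 210 = 560 · 3, and 96 = 2 · 240 / 5. The exponent 12 is the least `t₀` with
-- `192 * suc t₀ ≤ 2 ^ t₀`.
prime-in-gap = prime-between 1680 240 210 3 560 5 96 566 12 numerator denominator numerator∣1680 denominator∣1680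
  refl refl refl (≤ᵇ⇒≤ 3 1680 tt) (≤ᵇ⇒≤ 7 560 tt) floors-excess≤1 floors-no-excess numerator-≤ refl refl selfPowers-gap
  refl (≤ᵇ⇒≤ (192 * 13) (2 ^ 12) tt) (≤ᵇ⇒≤ 570 (2 ^ 12) tt)

-- Small n

trialDivision : (fuel d n : ℕ) .{{_ : NonZero d}} → Bool
trialDivision zero       d n = false
trialDivision (suc fuel) d n = (n <ᵇ d * d) ∨ ((0 <ᵇ n % d) ∧ trialDivision fuel (suc d) n)

-- The invariant is that `n` has no nontrivial divisor below `d`; once `n < d * d` this gives
-- primality. Exhausted fuel answers `false`, so it never certifies anything.
trialDivision⇒prime : ∀ fuel d {n} .{{_ : NonZero d}} .{{_ : NonTrivial n}} →
                      T (trialDivision fuel d n) → d Rough n → Prime n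
trialDivision⇒prime (suc fuel) d {n} ok rough with Equivalence.to (T-∨ {n <ᵇ d * d}) ok
... | inj₁ n<d² = rough∧square>⇒prime rough (<ᵇ⇒< n (d * d) n<d²)
... | inj₂ rest with Equivalence.to (T-∧ {0 <ᵇ n % d}) rest
...   | 0<n%d , ok′ = trialDivision⇒prime fuel (suc d) ok′
  (∤⇒rough-suc (λ d∣n → <⇒≢ (<ᵇ⇒< 0 (n % d) 0<n%d) (sym (n∣m⇒m%n≡0 n d d∣n))) rough)

isPrime : ℕ → Bool
isPrime n = (1 <ᵇ n) ∧ trialDivision n 2 n

isPrime⇒prime : ∀ {n} → T (isPrime n) → Prime n
isPrime⇒prime {n} ok with Equivalence.to (T-∧ {1 <ᵇ n}) ok
... | 1<n , ok′ = trialDivision⇒prime n 2 {{_}} {{n>1⇒nonTrivial (<ᵇ⇒< 1 n 1<n)}} ok′ 2-rough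

-- A prime p < 7 a settles all n with a ≤ n < p / 6, and (p + 5) / 6 rounds p / 6 up.
covers : ℕ → List ℕ → ℕ → Bool
covers a []       e = e ≤ᵇ a
covers a (p ∷ ps) e = (p <ᵇ 7 * a) ∧ (isPrime p ∧ covers ((p + 5) / 6) ps e)

covers⇒prime : ∀ a ps e → T (covers a ps e) → ∀ n → a ≤ n → n < e →
               ∃[ p ] (Prime p × 6 * n < p × p < 7 * n)
covers⇒prime a []       e ok n a≤n n<e = contradiction (≤-trans (≤ᵇ⇒≤ e a ok) a≤n) (<⇒≱ n<e)
covers⇒prime a (p ∷ ps) e ok n a≤n n<e with Equivalence.to (T-∧ {p <ᵇ 7 * a}) ok
... | p<7a , ok′ with Equivalence.to (T-∧ {isPrime p}) ok′ | 6 * n <? p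
...   | pp , _  | yes 6n<p = p , isPrime⇒prime pp , 6n<p , <-≤-trans (<ᵇ⇒< p (7 * a) p<7a) (*-monoʳ-≤ 7 a≤n)
...   | _ , ok″ | no 6n≮p  = covers⇒prime ((p + 5) / 6) ps e ok″ n (s≤s⁻¹ (m<n*o⇒m/o<n p+5<)) n<e
  where
  open ≤-Reasoning
  p+5< : p + 5 < suc n * 6
  p+5< = begin-strict
    p + 5       ≤⟨ +-monoˡ-≤ 5 (≮⇒≥ 6n≮p) ⟩
    6 * n + 5   <⟨ +-monoʳ-< (6 * n) (n<1+n 5) ⟩
    6 * n + 6   ≡⟨ trans (+-comm (6 * n) 6) (cong (6 +_) (*-comm 6 n)) ⟩
    suc n * 6   ∎

-- Each entry is a prime shortly below `7 * a`, where `a` is the least value its predecessors leave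
-- open. The last entry leaves open only n ≥ 2678674, beyond the required 2400000.
primeChain : List ℕ
primeChain =
  31 ∷ 41 ∷ 47 ∷ 53 ∷ 61 ∷ 73 ∷ 89 ∷ 103 ∷ 113 ∷ 131 ∷ 151 ∷ 181 ∷ 211 ∷ 251 ∷ 293 ∷ 337 ∷
  397 ∷ 467 ∷ 541 ∷ 631 ∷ 739 ∷ 863 ∷ 997 ∷ 1163 ∷ 1327 ∷ 1553 ∷ 1811 ∷ 2113 ∷ 2467 ∷ 2879 ∷
  3359 ∷ 3919 ∷ 4567 ∷ 5333 ∷ 6221 ∷ 7253 ∷ 8461 ∷ 9871 ∷ 11519 ∷ 13421 ∷ 15649 ∷ 18257 ∷
  21283 ∷ 24821 ∷ 28949 ∷ 33773 ∷ 39397 ∷ 45959 ∷ 53617 ∷ 62549 ∷ 72973 ∷ 85133 ∷ 99317 ∷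
  115861 ∷ 135173 ∷ 157679 ∷ 183959 ∷ 214607 ∷ 250361 ∷ 292081 ∷ 340757 ∷ 397549 ∷ 463807 ∷
  541097 ∷ 631273 ∷ 736471 ∷ 859213 ∷ 1002403 ∷ 1169473 ∷ 1364381 ∷ 1591753 ∷ 1857049 ∷
  2166557 ∷ 2527643 ∷ 2948917 ∷ 3440399 ∷ 4013783 ∷ 4682737 ∷ 5463197 ∷ 6373709 ∷ 7435979 ∷
  8675309 ∷ 10121183 ∷ 11808031 ∷ 13776031 ∷ 16072039 ∷ []

small-case : ∀ n → 5 ≤ n → n < 2400000 → ∃[ p ] (Prime p × 6 * n < p × p < 7 * n)
small-case = covers⇒prime 5 primeChain 2400000 tt

-- Large n

-- Makes the upper bound strict: `p ≤ 240 * q ≤ 7 * n` still allows `p = 7 * n`, which is composite.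
prime≢* : ∀ {p a b} → Prime p → 2 ≤ a → 2 ≤ b → p ≢ a * b
prime≢* {a = a} {b} pp 2≤a 2≤b refl with prime⇒irreducible pp (m∣m*n {a} b)
... | inj₁ a≡1  = <⇒≢ 2≤a (sym a≡1)
... | inj₂ a≡ab = <⇒≢ (m<m*n a b {{>-nonZero (≤-trans (s≤s z≤n) 2≤a)}} 2≤b) a≡ab

-- After multiplication by 7, the slack 7 · 210 - 6 · 240 = 30 per unit of `q` must cover the
-- rounding error 6 · 240 = 30 · 48.
7n<240[1+q]⇒6n<210q : ∀ n q → 48 ≤ q → 7 * n < 240 * suc q → 6 * n < 210 * q
7n<240[1+q]⇒6n<210q n q 48≤q lt = *-cancelˡ-< 7 (6 * n) (210 * q) (begin-strict
  7 * (6 * n)         ≡⟨ swap n ⟩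
  6 * (7 * n)         <⟨ *-monoʳ-< 6 lt ⟩
  6 * (240 * suc q)   ≡⟨ expand q ⟩
  30 * 48 + 1440 * q  ≤⟨ +-monoˡ-≤ (1440 * q) (*-monoʳ-≤ 30 48≤q) ⟩
  30 * q + 1440 * q   ≡⟨ collect q ⟩
  7 * (210 * q)       ∎)
  where
  open ≤-Reasoning
  swap : ∀ n → 7 * (6 * n) ≡ 6 * (7 * n)
  swap = solve-∀
  expand : ∀ q → 6 * (240 * suc q) ≡ 30 * 48 + 1440 * q
  expand = solve-∀
  collect : ∀ q → 30 * q + 1440 * q ≡ 7 * (210 * q)
  collect = solve-∀

m<n*[1+m/n] : ∀ m n .{{_ : NonZero n}} → m < n * suc (m / n)
m<n*[1+m/n] m n = begin-strict
  m                   ≡⟨ m≡m%n+[m/n]*n m n ⟩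
  m % n + m / n * n   <⟨ +-monoˡ-< (m / n * n) (m%n<n m n) ⟩
  suc (m / n) * n     ≡⟨ *-comm (suc (m / n)) n ⟩
  n * suc (m / n)     ∎
  where open ≤-Reasoning

n*[m/n]≤m : ∀ m n .{{_ : NonZero n}} → n * (m / n) ≤ m
n*[m/n]≤m m n = ≤-trans (≤-reflexive (*-comm n (m / n))) (m/n*n≤m m n)

-- The bound 70000 is 2 ^ 24 / 240 rounded up to a convenient value; it corresponds to n = 2400000,
-- as 7 · 2400000 = 240 · 70000.
prime-of-quotient : ∀ n q → 70000 ≤ q → 2 ≤ n → 240 * q ≤ 7 * n → 7 * n < 240 * suc q →
                    ∃[ p ] (Prime p × 6 * n < p × p < 7 * n)
prime-of-quotient n q large 2≤n lo hi =
  let p , pp , 210q<p , p≤240q = prime-in-gap q {{>-nonZero (≤-trans (≤ᵇ⇒≤ 1 70000 tt) large)}}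
        (≤-trans (≤ᵇ⇒≤ (2 ^ 12 * 2 ^ 12) (240 * 70000) tt) (*-monoʳ-≤ 240 large))
  in p , pp , <-trans (7n<240[1+q]⇒6n<210q n q (≤-trans (≤ᵇ⇒≤ 48 70000 tt) large) hi) 210q<p
     , ≤∧≢⇒< (≤-trans p≤240q lo) (prime≢* {a = 7} {b = n} pp (s≤s (s≤s z≤n)) 2≤n)

large-case : ∀ n → 2400000 ≤ n → ∃[ p ] (Prime p × 6 * n < p × p < 7 * n)
large-case n large = prime-of-quotient n (7 * n / 240) (/-monoˡ-≤ {7 * 2400000} {7 * n} 240 (*-monoʳ-≤ 7 large))
  (≤-trans (≤ᵇ⇒≤ 2 2400000 tt) large)
  (n*[m/n]≤m (7 * n) 240)
  (m<n*[1+m/n] (7 * n) 240)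

corollary2p2p13 : ∀ (n : ℕ) → n > 4 → ∃[ p ] (Prime p × 6 * n < p × p < 7 * n)
corollary2p2p13 n n>4 with n <? 2400000
... | yes n< = small-case n n>4 n<
... | no n≮  = large-case n (≮⇒≥ n≮)
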